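{- Let $G$ be a simple graph on $n$ vertices with adjacency matrix $A$ and walk-matrix $W=[e,Ae,\dots,A^{n-1}e]$ ($e$ the all-one vector), and assume $\det(W)\neq 0$. Let $Q$ be a rational orthogonal matrix with $Qe=e$ such that $Q^TAQ$ is a symmetric $(0,1)$-matrix with zero diagonal, and let $\ell$ be the level of $Q$. Let $p$ be an odd prime dividing $\ell$. Assume $\mathrm{rank}_p(W)=n-1$ and $\mathrm{rank}_p(\ell Q)=1$, and let $z$ be an integral vector satisfying $$W^Tz\equiv 0,\quad z^Tz\equiv 0,\quad z\not\equiv 0\pmod p.$$ Then there is an integer $\lambda_0$ with $Az\equiv\lambda_0 z\pmod p$, and for such $\lambda_0$ we have $z^TAz\equiv \lambda_0\, z^Tz \pmod{p^2}$.
   Context: The level of a rational matrix $Q$ is the smallest positive integer $\ell$ such that $\ell Q$ is integral. $\mathrm{rank}_p(M)$ denotes the rank of an integral matrix $M$ over $\mathbf{F}_p$. Congruences of vectors are entrywise. -}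

module Defs where

open import Data.Nat as ℕ using (ℕ; zero; suc)
open import Data.Fin using (Fin; zero; suc; punchIn; toℕ; _≟_)
open import Data.Integer as ℤ using (ℤ; +_)
open import Data.Integer.Divisibility using () renaming (_∣_ to _∣ℤ_)
open import Data.Rational as ℚ using (ℚ; 0ℚ; 1ℚ)
open import Data.Product using (Σ; ∃; _×_)
open import Relation.Binary.PropositionalEquality using (_≡_)
open import Relation.Nullary using (¬_; yes; no)
open import Data.Sum using (_⊎_)

Matℤ : ℕ → ℕ → Set
Matℤ m n = Fin m → Fin n → ℤ

Vecℤ : ℕ → Set
Vecℤ n = Fin n → ℤ

Matℚ : ℕ → ℕ → Set
Matℚ m n = Fin m → Fin n → ℚ

Σℤ : ∀ {n} → (Fin n → ℤ) → ℤ
Σℤ {zero} f = + 0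
Σℤ {suc n} f = f zero ℤ.+ Σℤ (λ i → f (suc i))

Σℚ : ∀ {n} → (Fin n → ℚ) → ℚ
Σℚ {zero} f = 0ℚ
Σℚ {suc n} f = f zero ℚ.+ Σℚ (λ i → f (suc i))

toℚ : ℤ → ℚ
toℚ z = z ℚ./ 1

_·ᵥ_ : ∀ {m n} → Matℤ m n → Vecℤ n → Vecℤ m
(M ·ᵥ v) i = Σℤ (λ j → M i j ℤ.* v j)

ones : ∀ {n} → Vecℤ n
ones _ = + 1

powOnes : ∀ {n} → Matℤ n n → ℕ → Vecℤ n
powOnes A zero = ones
powOnes A (suc k) = A ·ᵥ powOnes A k

walkMatrix : ∀ {n} → Matℤ n n → Matℤ n n
walkMatrix A i k = powOnes A (toℕ k) i

signPow : ℕ → ℤ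
signPow zero = + 1
signPow (suc k) = ℤ.- signPow k

det : ∀ {n} → Matℤ n n → ℤ
det {zero} M = + 1
det {suc n} M = Σℤ (λ j → sgn j ℤ.* (M zero j ℤ.* det (λ i k → M (suc i) (punchIn j k))))
  where
  sgn : Fin (suc n) → ℤ
  sgn j = signPow (toℕ j)

IsAdjacency : ∀ {n} → Matℤ n n → Set
IsAdjacency A = (∀ i j → A i j ≡ A j i)
              × (∀ i j → (A i j ≡ + 0) ⊎ (A i j ≡ + 1))
              × (∀ i → A i i ≡ + 0)

_≡_[mod_] : ℤ → ℤ → ℕ → Set
a ≡ b [mod m ] = (+ m) ∣ℤ (a ℤ.- b)

LinIndepMod : ℕ → ∀ {r m} → (Fin r → Vecℤ m) → Set
LinIndepMod p {r} v = ∀ (c : Fin r → ℤ)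
  → (∀ i → Σℤ (λ j → c j ℤ.* v j i) ≡ + 0 [mod p ])
  → ∀ j → c j ≡ + 0 [mod p ]

HasRankMod : ℕ → ∀ {m n} → Matℤ m n → ℕ → Set
HasRankMod p {m} {n} M r =
    (Σ (Fin r → Fin n) λ σ → LinIndepMod p (λ k i → M i (σ k)))
  × (∀ (σ : Fin (suc r) → Fin n) → ¬ LinIndepMod p (λ k i → M i (σ k)))

transposeMulℚ : ∀ {n} → Matℚ n n → Matℚ n n → Matℚ n n
transposeMulℚ P R i j = Σℚ (λ k → P k i ℚ.* R k j)

mulℚ : ∀ {n} → Matℚ n n → Matℚ n n → Matℚ n n
mulℚ P R i j = Σℚ (λ k → P i k ℚ.* R k j)

toℚMat : ∀ {n} → Matℤ n n → Matℚ n n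
toℚMat A i j = toℚ (A i j)

IsOrthogonal : ∀ {n} → Matℚ n n → Set
IsOrthogonal {n} Q = ∀ i j → transposeMulℚ Q Q i j ≡ δ i j
  where
  δ : Fin n → Fin n → ℚ
  δ i j with i ≟ j
  ... | yes _ = 1ℚ
  ... | no _ = 0ℚ

FixesOnes : ∀ {n} → Matℚ n n → Set
FixesOnes Q = ∀ i → Σℚ (λ j → Q i j) ≡ 1ℚ

IsIntegral : ℚ → Set
IsIntegral q = ∃ λ (z : ℤ) → q ≡ toℚ z

scaleℚ : ℕ → ℚ → ℚ
scaleℚ m q = toℚ (+ m) ℚ.* q

IsAdjacencyℚ : ∀ {n} → Matℚ n n → Set
IsAdjacencyℚ B = (∀ i j → B i j ≡ B j i)
               × (∀ i j → (B i j ≡ 0ℚ) ⊎ (B i j ≡ 1ℚ))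
               × (∀ i → B i i ≡ 0ℚ)

IsLevel : ∀ {n} → Matℚ n n → ℕ → Set
IsLevel Q ℓ = (1 ℕ.≤ ℓ)
            × (∀ i j → IsIntegral (scaleℚ ℓ (Q i j)))
            × (∀ m → 1 ℕ.≤ m → m ℕ.< ℓ → ¬ (∀ i j → IsIntegral (scaleℚ m (Q i j))))

module Submission where

-- Lemma 3.3.  Write L = ℓQ (integral) and let W be the walk matrix.
--
-- 1. The rational hypotheses on Q become integral identities for L:
--    LᵀL = ℓ²I, Le = ℓe and LᵀAL = ℓ²B with B integral (ScaledOrthogonal).
-- 2. Over ℤ any n + 1 vectors of ℤⁿ are dependent, so only 0 is orthogonal to
--    all columns of L; hence also LLᵀ = ℓ²I, AL = LB and Lᵀe = ℓe.  As p ∣ ℓ,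
--    induction on k makes every column of L orthogonal mod p to all walk
--    vectors Aᵏe (walk-orthogonal).
-- 3. By the same dependence over 𝔽_p, rank_p W = n − 1 forces the vectors
--    orthogonal mod p to the columns of W onto a line (orthogonal-line), so z
--    and every column of L are proportional mod p.  A column with an entry
--    ≢ 0 (rank_p L = 1) is a unit multiple cz, and AL = LB turns this into
--    Az ≡ λ₀z (mod p) (eigenvector-mod-p).
-- 4. That column X satisfies XᵀX = ℓ², XᵀAX = ℓ²b ≡ 0 (mod p²).  Expanding
--    X = cz + p·r shows Xᵀ(AX − λ₀X) ≡ c² zᵀ(Az − λ₀z) (mod p²), and c² is a
--    unit modulo p² (quadratic-form-mod-p²).

open import Defs
open import Data.Nat using (ℕ; suc; _∸_; _^_)
open import Data.Nat.Divisibility using (_∣_)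
open import Data.Nat.Primality using (Prime)
open import Data.Integer using (ℤ; +_; _*_)
open import Data.Product using (∃; _×_)
open import Relation.Binary.PropositionalEquality using (_≡_; _≢_)
open import Relation.Nullary using (¬_)

open import Data.Nat as ℕ using (zero)
import Data.Nat.Properties as ℕP
import Data.Nat.Divisibility as ℕD
open import Data.Nat.Primality using (euclidsLemma; ¬prime[1]; prime⇒irreducible)
open import Data.Nat.Coprimality as Coprimality using (Coprime; coprime-divisor; coprime-Bézout)
open import Data.Nat.GCD using (module Bézout)
open import Data.Integer as ℤ using (_+_; -_; _-_)
import Data.Integer.Properties as ℤP
import Data.Integer.Divisibility.Signed as ℤD
open import Data.Integer.Tactic.RingSolver using (solve-∀)
open import Data.Fin as F using (Fin; punchIn)
open import Data.Fin.Properties using (punchInᵢ≢i; punchIn-punchOut; all?; ¬∀⟶∃¬)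
open import Data.Vec.Functional using (_∷_; insertAt)
open import Data.Vec.Functional.Properties using (insertAt-lookup; insertAt-punchIn)
open import Data.Bool using (if_then_else_)
open import Data.Product using (_,_; proj₁; proj₂)
open import Data.Sum as Sum using (_⊎_; inj₁; inj₂)
open import Data.Empty using (⊥-elim)
open import Function using (_∘_)
open import Relation.Binary.PropositionalEquality
  using (refl; sym; trans; cong; cong₂; subst; module ≡-Reasoning)
open import Relation.Nullary using (Dec; yes; no)
import Relation.Nullary.Decidable as Dec
open import Relation.Binary.Bundles using (Setoid)
open import Relation.Binary.Structures using (IsEquivalence)
import Relation.Binary.Reasoning.Setoid as SetoidReasoning
open import Data.Rational as ℚ using (ℚ)
import Data.Rational.Properties as ℚP
open import Data.Rational.Unnormalised as ℚᵘ using (mkℚᵘ) renaming (_≃_ to _≃ᵘ_)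
import Data.Rational.Unnormalised.Properties as ℚᵘP
open import Algebra.Bundles using (CommutativeMonoid)
open import Algebra.Properties.CommutativeSemigroup
  (CommutativeMonoid.commutativeSemigroup ℚP.*-1-commutativeMonoid)
  using () renaming (interchange to ℚ-interchange; x∙yz≈y∙xz to ℚ-x∙yz≈y∙xz)
open import Algebra.Properties.Semiring.Sum ℤP.+-*-semiring
  using (sum; ∑-distrib-+; ∑-comm; sum-remove; *-distribˡ-sum; sum-replicate-zero)

Σℤ≡sum : ∀ {n} (f : Fin n → ℤ) → Σℤ f ≡ sum f
Σℤ≡sum {zero} f = refl
Σℤ≡sum {suc n} f = cong (_+_ (f F.zero)) (Σℤ≡sum (f ∘ F.suc))

Σ-cong : ∀ {n} {f g : Fin n → ℤ} → (∀ i → f i ≡ g i) → Σℤ f ≡ Σℤ g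
Σ-cong {zero} f≗g = refl
Σ-cong {suc n} f≗g = cong₂ _+_ (f≗g F.zero) (Σ-cong (f≗g ∘ F.suc))

Σ-+ : ∀ {n} (f g : Fin n → ℤ) → Σℤ (λ i → f i + g i) ≡ Σℤ f + Σℤ g
Σ-+ f g rewrite Σℤ≡sum f | Σℤ≡sum g | Σℤ≡sum (λ i → f i + g i) = ∑-distrib-+ f g

Σ-*ˡ : ∀ {n} c (f : Fin n → ℤ) → Σℤ (λ i → c * f i) ≡ c * Σℤ f
Σ-*ˡ c f rewrite Σℤ≡sum f | Σℤ≡sum (λ i → c * f i) = sym (*-distribˡ-sum c f)

Σ-*ʳ : ∀ {n} (f : Fin n → ℤ) c → Σℤ (λ i → f i * c) ≡ Σℤ f * c
Σ-*ʳ f c = trans (Σ-cong (λ i → ℤP.*-comm (f i) c)) (trans (Σ-*ˡ c f) (ℤP.*-comm c (Σℤ f)))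

Σ-zero : ∀ n → Σℤ {n} (λ _ → + 0) ≡ + 0
Σ-zero n rewrite Σℤ≡sum {n} (λ _ → + 0) = sum-replicate-zero n

Σ-remove : ∀ {n} (k : Fin (suc n)) (f : Fin (suc n) → ℤ) → Σℤ f ≡ f k + Σℤ (f ∘ punchIn k)
Σ-remove k f rewrite Σℤ≡sum f | Σℤ≡sum (f ∘ punchIn k) = sum-remove {i = k} f

Σ-swap : ∀ {m n} (f : Fin m → Fin n → ℤ) → Σℤ (λ i → Σℤ (f i)) ≡ Σℤ (λ j → Σℤ (λ i → f i j))
Σ-swap f = begin
  Σℤ (λ i → Σℤ (f i))             ≡⟨ Σ-cong (Σℤ≡sum ∘ f) ⟩
  Σℤ (λ i → sum (f i))            ≡⟨ Σℤ≡sum (λ i → sum (f i)) ⟩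
  sum (λ i → sum (f i))           ≡⟨ ∑-comm f ⟩
  sum (λ j → sum (λ i → f i j))   ≡⟨ sym (Σℤ≡sum (λ j → sum (λ i → f i j))) ⟩
  Σℤ (λ j → sum (λ i → f i j))    ≡⟨ sym (Σ-cong (λ j → Σℤ≡sum (λ i → f i j))) ⟩
  Σℤ (λ j → Σℤ (λ i → f i j))     ∎
  where open ≡-Reasoning

Σ-distrib-swap : ∀ {m n} (f : Fin m → ℤ) (g : Fin m → Fin n → ℤ) →
  Σℤ (λ i → f i * Σℤ (g i)) ≡ Σℤ (λ j → Σℤ (λ i → f i * g i j))
Σ-distrib-swap f g = trans (Σ-cong (λ i → sym (Σ-*ˡ (f i) (g i)))) (Σ-swap (λ i j → f i * g i j))

infix 4 _≈_⟨mod_⟩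

-- Congruence modulo m.  Unlike the frozen `_≡_[mod_]`, which unfolds to
-- divisibility of an absolute value, this record lets Agda infer both sides.
record _≈_⟨mod_⟩ (a b : ℤ) (m : ℕ) : Set where
  constructor ⟦_⟧
  field divides-difference : + m ℤD.∣ (a - b)
open _≈_⟨mod_⟩

fromMod : ∀ {a b m} → a ≡ b [mod m ] → a ≈ b ⟨mod m ⟩
fromMod d = ⟦ ℤD.∣ᵤ⇒∣ d ⟧

toMod : ∀ {a b m} → a ≈ b ⟨mod m ⟩ → a ≡ b [mod m ]
toMod d = ℤD.∣⇒∣ᵤ (divides-difference d)

module _ {m : ℕ} where

  ≈-via : ∀ {a b c d e f} → a - b ≡ (c - d) + (e - f) →
    c ≈ d ⟨mod m ⟩ → e ≈ f ⟨mod m ⟩ → a ≈ b ⟨mod m ⟩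
  ≈-via eq ⟦ x ⟧ ⟦ y ⟧ = ⟦ subst (+ m ℤD.∣_) (sym eq) (ℤD.∣m∣n⇒∣m+n x y) ⟧

  ≈-reflexive : ∀ {a b} → a ≡ b → a ≈ b ⟨mod m ⟩
  ≈-reflexive {a} refl = ⟦ ℤD.divides (+ 0) (ℤP.+-inverseʳ a) ⟧

  ≈-refl : ∀ {a} → a ≈ a ⟨mod m ⟩
  ≈-refl = ≈-reflexive refl

  ≈-sym : ∀ {a b} → a ≈ b ⟨mod m ⟩ → b ≈ a ⟨mod m ⟩
  ≈-sym {a} {b} ⟦ x ⟧ = ⟦ subst (+ m ℤD.∣_) (swap a b) (ℤD.∣m⇒∣-m x) ⟧
    where swap : ∀ a b → - (a - b) ≡ b - a
          swap = solve-∀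

  ≈-trans : ∀ {a b c} → a ≈ b ⟨mod m ⟩ → b ≈ c ⟨mod m ⟩ → a ≈ c ⟨mod m ⟩
  ≈-trans {a} {b} {c} = ≈-via (telescope a b c)
    where telescope : ∀ a b c → a - c ≡ (a - b) + (b - c)
          telescope = solve-∀

  ≈-isEquivalence : IsEquivalence (λ a b → a ≈ b ⟨mod m ⟩)
  ≈-isEquivalence = record { refl = ≈-refl ; sym = ≈-sym ; trans = ≈-trans }

  +-cong : ∀ {a b c d} → a ≈ b ⟨mod m ⟩ → c ≈ d ⟨mod m ⟩ → a + c ≈ b + d ⟨mod m ⟩
  +-cong {a} {b} {c} {d} = ≈-via (regroup a b c d)
    where regroup : ∀ a b c d → (a + c) - (b + d) ≡ (a - b) + (c - d)
          regroup = solve-∀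

  *-cong : ∀ {a b c d} → a ≈ b ⟨mod m ⟩ → c ≈ d ⟨mod m ⟩ → a * c ≈ b * d ⟨mod m ⟩
  *-cong {a} {b} {c} {d} ⟦ x ⟧ ⟦ y ⟧ =
    ⟦ subst (+ m ℤD.∣_) (sym (split a b c d)) (ℤD.∣m∣n⇒∣m+n (ℤD.∣m⇒∣m*n c x) (ℤD.∣n⇒∣m*n b y)) ⟧
    where split : ∀ a b c d → a * c - b * d ≡ (a - b) * c + b * (c - d)
          split = solve-∀

  -‿cong : ∀ {a b} → a ≈ b ⟨mod m ⟩ → - a ≈ - b ⟨mod m ⟩
  -‿cong {a} {b} ⟦ x ⟧ = ⟦ subst (+ m ℤD.∣_) (negate a b) (ℤD.∣m⇒∣-m x) ⟧
    where negate : ∀ a b → - (a - b) ≡ - a - - b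
          negate = solve-∀

  sub-cong : ∀ {a b c d} → a ≈ b ⟨mod m ⟩ → c ≈ d ⟨mod m ⟩ → a - c ≈ b - d ⟨mod m ⟩
  sub-cong x y = +-cong x (-‿cong y)

  Σ-congₘ : ∀ {n} {f g : Fin n → ℤ} → (∀ i → f i ≈ g i ⟨mod m ⟩) → Σℤ f ≈ Σℤ g ⟨mod m ⟩
  Σ-congₘ {zero} f≈g = ≈-refl
  Σ-congₘ {suc n} f≈g = +-cong (f≈g F.zero) (Σ-congₘ (f≈g ∘ F.suc))

  ≈-dec : ∀ a b → Dec (a ≈ b ⟨mod m ⟩)
  ≈-dec a b = Dec.map′ ⟦_⟧ divides-difference (+ m ℤD.∣? (a - b))

≈-setoid : ℕ → Setoid _ _
≈-setoid m = record { isEquivalence = ≈-isEquivalence {m} }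

module ≈-Reasoning (m : ℕ) = SetoidReasoning (≈-setoid m)

+-vanishˡ : ∀ {m a b} → a + b ≈ + 0 ⟨mod m ⟩ → b ≈ + 0 ⟨mod m ⟩ → a ≈ + 0 ⟨mod m ⟩
+-vanishˡ {a = a} {b} a+b≈0 b≈0 = ≈-via (regroup a b) a+b≈0 (≈-sym b≈0)
  where regroup : ∀ a b → a - + 0 ≡ (a + b - + 0) + (+ 0 - b)
        regroup = solve-∀

difference≈0⇒≈ : ∀ {m a b} → a - b ≈ + 0 ⟨mod m ⟩ → a ≈ b ⟨mod m ⟩
difference≈0⇒≈ {a = a} {b} d = ≈-via (regroup a b) d (≈-refl {a = b})
  where regroup : ∀ a b → a - b ≡ (a - b - + 0) + (b - b)
        regroup = solve-∀

≈⇒difference≈0 : ∀ {m a b} → a ≈ b ⟨mod m ⟩ → a - b ≈ + 0 ⟨mod m ⟩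
≈⇒difference≈0 {a = a} {b} a≈b = ≈-via (regroup a b) a≈b (≈-refl {a = b})
  where regroup : ∀ a b → a - b - + 0 ≡ (a - b) + (b - b)
        regroup = solve-∀

∣⇒≈0 : ∀ {m a} → m ∣ ℤ.∣ a ∣ → a ≈ + 0 ⟨mod m ⟩
∣⇒≈0 {a = a} d = fromMod (subst (λ x → _ ∣ ℤ.∣ x ∣) (sym (ℤP.+-identityʳ a)) d)

≈0⇒∣ : ∀ {m a} → a ≈ + 0 ⟨mod m ⟩ → m ∣ ℤ.∣ a ∣
≈0⇒∣ {a = a} d = subst (λ x → _ ∣ ℤ.∣ x ∣) (ℤP.+-identityʳ a) (toMod d)

≈-mod0⇒≡ : ∀ {a b} → a ≈ b ⟨mod 0 ⟩ → a ≡ b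
≈-mod0⇒≡ {a} {b} ⟦ x ⟧ = ℤP.i-j≡0⇒i≡j a b (ℤD.0∣⇒≡0 x)

mod-square : ∀ {p a b} → a ≈ b ⟨mod p ℕ.* p ⟩ → a ≈ b ⟨mod p ^ 2 ⟩
mod-square {p} {a} {b} = subst (λ k → a ≈ b ⟨mod k ⟩) (cong (p ℕ.*_) (sym (ℕP.*-identityʳ p)))

*-multiples : ∀ {m k a b} → a ≈ + 0 ⟨mod m ⟩ → b ≈ + 0 ⟨mod k ⟩ → a * b ≈ + 0 ⟨mod m ℕ.* k ⟩
*-multiples {a = a} {b} x y =
  ∣⇒≈0 (subst (_ ∣_) (sym (ℤP.abs-* a b)) (ℕD.*-pres-∣ (≈0⇒∣ x) (≈0⇒∣ y)))

*-perturb : ∀ {m k a a′ b} → a ≈ a′ ⟨mod m ⟩ → b ≈ + 0 ⟨mod k ⟩ → a * b ≈ a′ * b ⟨mod m ℕ.* k ⟩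
*-perturb {a = a} {a′} {b} a≈a′ b≈0 =
  difference≈0⇒≈ (≈-trans (≈-reflexive (factor a a′ b)) (*-multiples (≈⇒difference≈0 a≈a′) b≈0))
  where factor : ∀ a a′ b → a * b - a′ * b ≡ (a - a′) * b
        factor = solve-∀

Σ-*-vanishing : ∀ {m n} (f : Fin n → ℤ) {g : Fin n → ℤ} → (∀ k → g k ≈ + 0 ⟨mod m ⟩) →
  Σℤ (λ k → f k * g k) ≈ + 0 ⟨mod m ⟩
Σ-*-vanishing {n = n} f g≈0 = ≈-trans (Σ-congₘ (λ k → *-cong (≈-refl {a = f k}) (g≈0 k)))
  (≈-reflexive (trans (Σ-cong (λ k → ℤP.*-zeroʳ (f k))) (Σ-zero n)))

-- ℤ/m is an integral domain: 1 is not 0 and there are no zero divisors.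
-- This holds for m = 0 (giving ℤ itself) and for m prime.
record DomainModulus (m : ℕ) : Set where
  field
    one≉zero : ¬ (+ 1 ≈ + 0 ⟨mod m ⟩)
    zero-divisor : ∀ {a b} → a * b ≈ + 0 ⟨mod m ⟩ → a ≈ + 0 ⟨mod m ⟩ ⊎ b ≈ + 0 ⟨mod m ⟩

  cancelˡ : ∀ {a b} → ¬ a ≈ + 0 ⟨mod m ⟩ → a * b ≈ + 0 ⟨mod m ⟩ → b ≈ + 0 ⟨mod m ⟩
  cancelˡ a≉0 ab≈0 with zero-divisor ab≈0
  ... | inj₁ a≈0 = ⊥-elim (a≉0 a≈0)
  ... | inj₂ b≈0 = b≈0

  nonzero-* : ∀ {a b} → ¬ a ≈ + 0 ⟨mod m ⟩ → ¬ b ≈ + 0 ⟨mod m ⟩ → ¬ a * b ≈ + 0 ⟨mod m ⟩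
  nonzero-* a≉0 b≉0 ab≈0 = b≉0 (cancelˡ a≉0 ab≈0)

prime-domain : ∀ {p} → Prime p → DomainModulus p
prime-domain {p} pp = record { one≉zero = one≉zero ; zero-divisor = zero-divisor }
  where
  one≉zero : ¬ (+ 1 ≈ + 0 ⟨mod p ⟩)
  one≉zero 1≈0 = ¬prime[1] (subst Prime (ℕD.∣1⇒≡1 (≈0⇒∣ 1≈0)) pp)
  zero-divisor : ∀ {a b} → a * b ≈ + 0 ⟨mod p ⟩ → a ≈ + 0 ⟨mod p ⟩ ⊎ b ≈ + 0 ⟨mod p ⟩
  zero-divisor {a} {b} ab≈0 =
    Sum.map ∣⇒≈0 ∣⇒≈0 (euclidsLemma ℤ.∣ a ∣ ℤ.∣ b ∣ pp (subst (p ∣_) (ℤP.abs-* a b) (≈0⇒∣ ab≈0)))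

integer-domain : DomainModulus 0
integer-domain = record { one≉zero = one≉zero ; zero-divisor = zero-divisor }
  where
  one≉zero : ¬ (+ 1 ≈ + 0 ⟨mod 0 ⟩)
  one≉zero 1≈0 with ≈-mod0⇒≡ 1≈0
  ... | ()
  zero-divisor : ∀ {a b} → a * b ≈ + 0 ⟨mod 0 ⟩ → a ≈ + 0 ⟨mod 0 ⟩ ⊎ b ≈ + 0 ⟨mod 0 ⟩
  zero-divisor {a} {b} ab≈0 = Sum.map ≈-reflexive ≈-reflexive (ℤP.i*j≡0⇒i≡0∨j≡0 a (≈-mod0⇒≡ ab≈0))

prime-coprime : ∀ {p m} → Prime p → ¬ p ∣ m → Coprime p m
prime-coprime pp p∤m (d∣p , d∣m) with prime⇒irreducible pp d∣p
... | inj₁ d≡1 = d≡1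
... | inj₂ refl = ⊥-elim (p∤m d∣m)

coprime-*ʳ : ∀ {m n k} → Coprime m n → Coprime m k → Coprime m (n ℕ.* k)
coprime-*ʳ m⊥n m⊥k (d∣m , d∣nk) =
  m⊥k (d∣m , coprime-divisor (λ (e∣d , e∣n) → m⊥n (ℕD.∣-trans e∣d d∣m , e∣n)) d∣nk)

coprime-square : ∀ {m n} → Coprime m n → Coprime (m ℕ.* m) (n ℕ.* n)
coprime-square m⊥n = Coprimality.sym (coprime-*ʳ n⊥mm n⊥mm)
  where n⊥mm : Coprime _ _
        n⊥mm = Coprimality.sym (coprime-*ʳ m⊥n m⊥n)

square-cancel : ∀ {p v x} → Prime p → ¬ v ≈ + 0 ⟨mod p ⟩ →
  v * v * x ≈ + 0 ⟨mod p ℕ.* p ⟩ → x ≈ + 0 ⟨mod p ℕ.* p ⟩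
square-cancel {p} {v} {x} pp v≉0 vvx≈0 = ∣⇒≈0 (coprime-divisor p²⊥v² p²∣v²x)
  where
  p²⊥v² : Coprime (p ℕ.* p) (ℤ.∣ v ∣ ℕ.* ℤ.∣ v ∣)
  p²⊥v² = coprime-square (prime-coprime pp (v≉0 ∘ ∣⇒≈0))
  p²∣v²x : p ℕ.* p ∣ ℤ.∣ v ∣ ℕ.* ℤ.∣ v ∣ ℕ.* ℤ.∣ x ∣
  p²∣v²x = subst (_ ∣_) (trans (ℤP.abs-* (v * v) x) (cong (ℕ._* ℤ.∣ x ∣) (ℤP.abs-* v v))) (≈0⇒∣ vvx≈0)

inverse-ℕ : ∀ {p m} → Prime p → ¬ p ∣ m → ∃ λ w → w * + m ≈ + 1 ⟨mod p ⟩
inverse-ℕ {p} {m} pp p∤m with coprime-Bézout (Coprimality.sym (prime-coprime pp p∤m))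
... | Bézout.+- x y eq = + x , ⟦ ℤD.divides (+ y) (begin
  + x * + m - + 1          ≡⟨ cong (_- + 1) (sym (ℤP.pos-* x m)) ⟩
  + (x ℕ.* m) - + 1        ≡⟨ cong (λ k → + k - + 1) (sym eq) ⟩
  + (1 ℕ.+ y ℕ.* p) - + 1  ≡⟨ cong (_- + 1) (ℤP.pos-+ 1 (y ℕ.* p)) ⟩
  + 1 + + (y ℕ.* p) - + 1  ≡⟨ cancel (+ (y ℕ.* p)) ⟩
  + (y ℕ.* p)              ≡⟨ ℤP.pos-* y p ⟩
  + y * + p                ∎) ⟧
  where open ≡-Reasoning
        cancel : ∀ c → + 1 + c - + 1 ≡ c
        cancel = solve-∀
... | Bézout.-+ x y eq = - + x , ⟦ ℤD.divides (- + y) (begin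
  - + x * + m - + 1        ≡⟨ negate (+ x) (+ m) ⟩
  - (+ 1 + + x * + m)      ≡⟨ cong (λ k → - (+ 1 + k)) (sym (ℤP.pos-* x m)) ⟩
  - (+ 1 + + (x ℕ.* m))    ≡⟨ cong -_ (sym (ℤP.pos-+ 1 (x ℕ.* m))) ⟩
  - + (1 ℕ.+ x ℕ.* m)      ≡⟨ cong (λ k → - + k) eq ⟩
  - + (y ℕ.* p)            ≡⟨ cong -_ (ℤP.pos-* y p) ⟩
  - (+ y * + p)            ≡⟨ ℤP.neg-distribˡ-* (+ y) (+ p) ⟩
  - + y * + p              ∎) ⟧
  where open ≡-Reasoning
        negate : ∀ a b → - a * b - + 1 ≡ - (+ 1 + a * b)
        negate = solve-∀

inverse : ∀ {p a} → Prime p → ¬ a ≈ + 0 ⟨mod p ⟩ → ∃ λ w → w * a ≈ + 1 ⟨mod p ⟩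
inverse {a = a} pp a≉0 with inverse-ℕ pp (a≉0 ∘ ∣⇒≈0) | ℤP.+∣i∣≡i⊎+∣i∣≡-i a
... | w , w∣a∣≈1 | inj₁ ∣a∣≡a = w , subst (λ c → w * c ≈ + 1 ⟨mod _ ⟩) ∣a∣≡a w∣a∣≈1
... | w , w∣a∣≈1 | inj₂ ∣a∣≡-a =
  - w , ≈-trans (≈-reflexive (flip w a)) (subst (λ c → w * c ≈ + 1 ⟨mod _ ⟩) ∣a∣≡-a w∣a∣≈1)
  where flip : ∀ w a → - w * a ≡ w * - a
        flip = solve-∀

infix 7 _·_

_·_ : ∀ {n} → Vecℤ n → Vecℤ n → ℤ
x · y = Σℤ (λ i → x i * y i)

column : ∀ {m n} → Matℤ m n → Fin n → Vecℤ m
column M j i = M i j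

·-comm : ∀ {n} (x y : Vecℤ n) → x · y ≡ y · x
·-comm x y = Σ-cong (λ i → ℤP.*-comm (x i) (y i))

self-adjoint : ∀ {n} {A : Matℤ n n} → (∀ i j → A i j ≡ A j i) →
  ∀ x y → x · (A ·ᵥ y) ≡ (A ·ᵥ x) · y
self-adjoint {A = A} symm x y = begin
  Σℤ (λ i → x i * Σℤ (λ j → A i j * y j))   ≡⟨ Σ-distrib-swap x (λ i j → A i j * y j) ⟩
  Σℤ (λ j → Σℤ (λ i → x i * (A i j * y j))) ≡⟨ Σ-cong (λ j → Σ-cong (λ i → regroup (x i) (A i j) (y j))) ⟩
  Σℤ (λ j → Σℤ (λ i → A i j * x i * y j))   ≡⟨ Σ-cong (λ j → Σ-*ʳ (λ i → A i j * x i) (y j)) ⟩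
  Σℤ (λ j → Σℤ (λ i → A i j * x i) * y j)   ≡⟨ Σ-cong (λ j → cong (_* y j) (Σ-cong (λ i → cong (_* x i) (symm i j)))) ⟩
  (A ·ᵥ x) · y                              ∎
  where open ≡-Reasoning
        regroup : ∀ a b c → a * (b * c) ≡ b * a * c
        regroup = solve-∀

·-add : ∀ {n} (x : Vecℤ n) a (y w : Vecℤ n) → x · (λ t → a * y t + w t) ≡ a * (x · y) + x · w
·-add x a y w = trans (Σ-cong (λ t → expand (x t) a (y t) (w t)))
                      (trans (Σ-+ (λ t → a * (x t * y t)) (λ t → x t * w t)) (cong (_+ x · w) (Σ-*ˡ a (λ t → x t * y t))))
  where expand : ∀ x a y w → x * (a * y + w) ≡ a * (x * y) + x * w
        expand = solve-∀

·-zeroʳ : ∀ {n} (x : Vecℤ n) {y : Vecℤ n} → (∀ t → y t ≡ + 0) → x · y ≡ + 0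
·-zeroʳ {n} x y≡0 = trans (Σ-cong (λ t → trans (cong (x t *_) (y≡0 t)) (ℤP.*-zeroʳ (x t)))) (Σ-zero n)

δ : ∀ {n} → Fin n → Fin n → ℤ
δ i j = if Dec.does (i F.≟ j) then + 1 else + 0

δ-sym : ∀ {n} (i j : Fin n) → δ i j ≡ δ j i
δ-sym i j with i F.≟ j | j F.≟ i
... | yes _ | yes _ = refl
... | no _ | no _ = refl
... | yes i≡j | no j≢i = ⊥-elim (j≢i (sym i≡j))
... | no i≢j | yes j≡i = ⊥-elim (i≢j (sym j≡i))

Σ-δ : ∀ {n} (f : Fin n → ℤ) (j : Fin n) → Σℤ (λ t → f t * δ t j) ≡ f j
Σ-δ {suc n} f j = begin
  Σℤ (λ t → f t * δ t j)                             ≡⟨ Σ-remove j (λ t → f t * δ t j) ⟩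
  f j * δ j j + Σℤ (λ i → f (punchIn j i) * δ (punchIn j i) j) ≡⟨ cong₂ _+_ (cong (f j *_) δ-diag) (Σ-cong δ-off) ⟩
  f j * + 1 + Σℤ {n} (λ _ → + 0)                     ≡⟨ cong₂ _+_ (ℤP.*-identityʳ (f j)) (Σ-zero n) ⟩
  f j + + 0                                         ≡⟨ ℤP.+-identityʳ (f j) ⟩
  f j                                               ∎
  where
  open ≡-Reasoning
  δ-diag : δ j j ≡ + 1
  δ-diag rewrite Dec.dec-true (j F.≟ j) refl = refl
  δ-off : ∀ i → f (punchIn j i) * δ (punchIn j i) j ≡ + 0
  δ-off i rewrite Dec.dec-false (punchIn j i F.≟ j) (punchInᵢ≢i j i) = ℤP.*-zeroʳ (f (punchIn j i))

record NontrivialRelation (m : ℕ) {N D} (v : Fin N → Vecℤ D) : Set where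
  field
    coeff : Fin N → ℤ
    witness : Fin N
    nontrivial : ¬ coeff witness ≈ + 0 ⟨mod m ⟩
    relation : ∀ d → Σℤ (λ k → coeff k * v k d) ≈ + 0 ⟨mod m ⟩

module Dependence {m : ℕ} (domain : DomainModulus m) where
  open DomainModulus domain

  relation-drop-first : ∀ {N D} (v : Fin (suc N) → Vecℤ (suc D)) →
    (∀ k → v k F.zero ≈ + 0 ⟨mod m ⟩) →
    NontrivialRelation m (λ k d → v (F.suc k) (F.suc d)) → NontrivialRelation m v
  relation-drop-first v first≈0 r = record
    { coeff = + 0 ∷ coeff
    ; witness = F.suc witness
    ; nontrivial = nontrivial
    ; relation = λ { F.zero → drop-zero (v F.zero F.zero) (Σ-*-vanishing coeff (λ k → first≈0 (F.suc k)))
                   ; (F.suc d) → drop-zero (v F.zero (F.suc d)) (relation d) }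
    }
    where
    open NontrivialRelation r
    drop-zero : ∀ a {s} → s ≈ + 0 ⟨mod m ⟩ → + 0 * a + s ≈ + 0 ⟨mod m ⟩
    drop-zero a {s} s≈0 = ≈-trans (≈-reflexive (ℤP.+-identityˡ s)) s≈0

  eliminate : ∀ {N D} (v : Fin (suc N) → Vecℤ (suc D)) → Fin (suc N) → Fin N → Vecℤ D
  eliminate v k i d = v k F.zero * v (punchIn k i) (F.suc d) - v (punchIn k i) F.zero * v k (F.suc d)

  -- Gaussian elimination, case 2: if v_k(0) ≢ 0, a relation c′ among the
  -- eliminated vectors lifts to the relation with c_k = −Σᵢ c′ᵢ vᵢ(0) and
  -- cᵢ = v_k(0)·c′ᵢ for the other vectors.
  relation-pivot : ∀ {N D} (v : Fin (suc N) → Vecℤ (suc D)) (k : Fin (suc N)) →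
    ¬ v k F.zero ≈ + 0 ⟨mod m ⟩ →
    NontrivialRelation m (eliminate v k) → NontrivialRelation m v
  relation-pivot {N} v k pivot r = record
    { coeff = c
    ; witness = punchIn k witness
    ; nontrivial = λ c≈0 → nonzero-* pivot nontrivial
                             (subst (λ x → x ≈ + 0 ⟨mod m ⟩) (insertAt-punchIn _ k _ witness) c≈0)
    ; relation = relation′
    }
    where
    open NontrivialRelation r
    a : ℤ
    a = v k F.zero
    other : Fin _ → Vecℤ _
    other i = v (punchIn k i)
    S₀ : ℤ
    S₀ = Σℤ (λ i → coeff i * other i F.zero)
    c : Vecℤ (suc N)
    c = insertAt (λ i → a * coeff i) k (- S₀)

    split : ∀ d → Σℤ (λ j → c j * v j d) ≡ - S₀ * v k d + Σℤ (λ i → a * coeff i * other i d)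
    split d = trans (Σ-remove k (λ j → c j * v j d))
      (cong₂ _+_ (cong (_* v k d) (insertAt-lookup _ k _))
                 (Σ-cong (λ i → cong (_* other i d) (insertAt-punchIn _ k _ i))))

    pull-a : ∀ d → Σℤ (λ i → a * coeff i * other i d) ≡ a * Σℤ (λ i → coeff i * other i d)
    pull-a d = trans (Σ-cong (λ i → ℤP.*-assoc a (coeff i) (other i d))) (Σ-*ˡ a (λ i → coeff i * other i d))

    relation′ : ∀ d → Σℤ (λ j → c j * v j d) ≈ + 0 ⟨mod m ⟩
    relation′ F.zero = ≈-reflexive (begin
      Σℤ (λ j → c j * v j F.zero)   ≡⟨ split F.zero ⟩
      - S₀ * a + Σℤ (λ i → a * coeff i * other i F.zero) ≡⟨ cong (_+_ (- S₀ * a)) (pull-a F.zero) ⟩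
      - S₀ * a + a * S₀             ≡⟨ cancel S₀ a ⟩
      + 0                           ∎)
      where open ≡-Reasoning
            cancel : ∀ s a → - s * a + a * s ≡ + 0
            cancel = solve-∀
    relation′ (F.suc d) = ≈-trans (≈-reflexive (begin
      Σℤ (λ j → c j * v j (F.suc d))                        ≡⟨ split (F.suc d) ⟩
      - S₀ * b + Σℤ (λ i → a * coeff i * other i (F.suc d)) ≡⟨ cong (_+_ (- S₀ * b)) (pull-a (F.suc d)) ⟩
      - S₀ * b + a * Σℤ (λ i → coeff i * other i (F.suc d)) ≡⟨ sym (Σ-pair (λ i → coeff i * other i (F.suc d))) ⟩
      Σℤ (λ i → a * (coeff i * other i (F.suc d)) - b * (coeff i * other i F.zero))
        ≡⟨ Σ-cong (λ i → expand a b (coeff i) (other i F.zero) (other i (F.suc d))) ⟩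
      Σℤ (λ i → coeff i * eliminate v k i d)                ∎)) (relation d)
      where
      open ≡-Reasoning
      b : ℤ
      b = v k (F.suc d)
      Σ-pair : ∀ f → Σℤ (λ i → a * f i - b * (coeff i * other i F.zero)) ≡ - S₀ * b + a * Σℤ f
      Σ-pair f = begin
        Σℤ (λ i → a * f i - b * (coeff i * other i F.zero))  ≡⟨ Σ-+ (λ i → a * f i) _ ⟩
        Σℤ (λ i → a * f i) + Σℤ (λ i → - (b * (coeff i * other i F.zero)))
          ≡⟨ cong₂ _+_ (Σ-*ˡ a f) (trans (Σ-cong (λ i → ℤP.neg-distribˡ-* b (coeff i * other i F.zero)))
                                         (Σ-*ˡ (- b) (λ i → coeff i * other i F.zero))) ⟩
        a * Σℤ f + - b * S₀                                 ≡⟨ reorder (a * Σℤ f) b S₀ ⟩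
        - S₀ * b + a * Σℤ f                                 ∎
        where reorder : ∀ x b s → x + - b * s ≡ - s * b + x
              reorder = solve-∀
      expand : ∀ a b γ x₀ x → a * (γ * x) - b * (γ * x₀) ≡ γ * (a * x - x₀ * b)
      expand = solve-∀

  dependent : ∀ D (v : Fin (suc D) → Vecℤ D) → NontrivialRelation m v
  dependent zero v = record
    { coeff = λ _ → + 1 ; witness = F.zero ; nontrivial = one≉zero ; relation = λ () }
  dependent (suc D) v with all? (λ k → ≈-dec (v k F.zero) (+ 0))
  ... | yes first≈0 = relation-drop-first v first≈0 (dependent D (λ k d → v (F.suc k) (F.suc d)))
  ... | no ¬first≈0 with ¬∀⟶∃¬ _ _ (λ k → ≈-dec (v k F.zero) (+ 0)) ¬first≈0
  ...   | k , pivot = relation-pivot v k pivot (dependent D (eliminate v k))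

punchIn-elim : ∀ {n} {P : Fin (suc n) → Set} (j : Fin (suc n)) →
  P j → (∀ i′ → P (punchIn j i′)) → ∀ i → P i
punchIn-elim {P = P} j Pj P-other i with j F.≟ i
... | yes refl = Pj
... | no j≢i = subst P (punchIn-punchOut j≢i) (P-other (F.punchOut j≢i))

Independent : ℕ → ∀ {r n} → (Fin r → Vecℤ n) → Set
Independent m {r} v =
  ∀ (c : Fin r → ℤ) → (∀ i → Σℤ (λ s → c s * v s i) ≈ + 0 ⟨mod m ⟩) → ∀ s → c s ≈ + 0 ⟨mod m ⟩

fromLinIndepMod : ∀ {p r n} {v : Fin r → Vecℤ n} → LinIndepMod p v → Independent p v
fromLinIndepMod {p} {v = v} indep c rel s =
  fromMod {m = p} (indep c (λ i → toMod {Σℤ (λ s → c s * v s i)} {+ 0} {p} (rel i)) s)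

independent-nonzero : ∀ {m n} → DomainModulus m → (v : Fin 1 → Vecℤ n) → Independent m v →
  ∃ λ i → ¬ v F.zero i ≈ + 0 ⟨mod m ⟩
independent-nonzero {m} domain v indep with all? (λ i → ≈-dec {m} (v F.zero i) (+ 0))
... | no ¬v≈0 = ¬∀⟶∃¬ _ _ (λ i → ≈-dec (v F.zero i) (+ 0)) ¬v≈0
... | yes v≈0 = ⊥-elim (DomainModulus.one≉zero domain (indep (λ _ → + 1) relation F.zero))
  where relation : ∀ i → + 1 * v F.zero i + + 0 ≈ + 0 ⟨mod m ⟩
        relation i = ≈-trans (≈-reflexive (trans (ℤP.+-identityʳ _) (ℤP.*-identityˡ _))) (v≈0 i)

Orthogonal : ℕ → ∀ {r n} → (Fin r → Vecℤ n) → Vecℤ n → Set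
Orthogonal m v x = ∀ s → v s · x ≈ + 0 ⟨mod m ⟩

orthogonal-combination : ∀ {m r n} (v : Fin r → Vecℤ n) {x} → Orthogonal m v x →
  ∀ a → x · (λ i → Σℤ (λ s → a s * v s i)) ≈ + 0 ⟨mod m ⟩
orthogonal-combination v {x} x⊥v a = ≈-trans (≈-reflexive (begin
  Σℤ (λ i → x i * Σℤ (λ s → a s * v s i))   ≡⟨ Σ-distrib-swap x (λ i s → a s * v s i) ⟩
  Σℤ (λ s → Σℤ (λ i → x i * (a s * v s i))) ≡⟨ Σ-cong (λ s → trans (Σ-cong (λ i → regroup (x i) (a s) (v s i))) (Σ-*ˡ (a s) (λ i → v s i * x i))) ⟩
  Σℤ (λ s → a s * (v s · x))                ∎)) (Σ-*-vanishing a x⊥v)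
  where open ≡-Reasoning
        regroup : ∀ x a v → x * (a * v) ≡ a * (v * x)
        regroup = solve-∀

orthogonal-difference : ∀ {m r n} (v : Fin r → Vecℤ n) {x y} → Orthogonal m v x → Orthogonal m v y →
  ∀ α β → Orthogonal m v (λ i → α * y i - β * x i)
orthogonal-difference v {x} {y} x⊥v y⊥v α β s = ≈-trans (≈-reflexive (begin
  Σℤ (λ i → v s i * (α * y i - β * x i))            ≡⟨ Σ-cong (λ i → expand (v s i) α (y i) β (x i)) ⟩
  Σℤ (λ i → α * (v s i * y i) + - β * (v s i * x i)) ≡⟨ Σ-+ (λ i → α * (v s i * y i)) (λ i → - β * (v s i * x i)) ⟩
  Σℤ (λ i → α * (v s i * y i)) + Σℤ (λ i → - β * (v s i * x i)) ≡⟨ cong₂ _+_ (Σ-*ˡ α (λ i → v s i * y i)) (Σ-*ˡ (- β) (λ i → v s i * x i)) ⟩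
  α * (v s · y) + - β * (v s · x)                   ∎))
  (≈-trans (+-cong (*-cong (≈-refl {a = α}) (y⊥v s)) (*-cong (≈-refl {a = - β}) (x⊥v s)))
           (≈-reflexive (vanish α β)))
  where open ≡-Reasoning
        expand : ∀ w α y β x → w * (α * y - β * x) ≡ α * (w * y) + - β * (w * x)
        expand = solve-∀
        vanish : ∀ α β → α * + 0 + - β * + 0 ≡ + 0
        vanish = solve-∀

module Complement {m : ℕ} (domain : DomainModulus m) where
  open DomainModulus domain
  open Dependence domain

  -- For n independent vectors of length n + 1: an orthogonal u vanishing at a
  -- coordinate j where some orthogonal x does not vanish vanishes everywhere.
  -- (A combination r of the vectors vanishing off j and another coordinate k
  -- pairs with x and u to force r ≡ 0, contradicting independence.)
  orthogonal-support : ∀ {n} (v : Fin n → Vecℤ (suc n)) → Independent m v →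
    ∀ {x u} → Orthogonal m v x → Orthogonal m v u →
    ∀ j → ¬ x j ≈ + 0 ⟨mod m ⟩ → u j ≈ + 0 ⟨mod m ⟩ → ∀ k′ → u (punchIn j k′) ≈ + 0 ⟨mod m ⟩
  orthogonal-support {zero} v indep x⊥v u⊥v j xj≉0 uj≈0 ()
  orthogonal-support {suc n} v indep {x} {u} x⊥v u⊥v j xj≉0 uj≈0 k′ =
    Dec.decidable-stable (≈-dec {m} (u k) (+ 0)) (λ uk≉0 → nontrivial (indep coeff (r≈0 uk≉0) witness))
    where
    k : Fin (suc (suc n))
    k = punchIn j k′
    -- a nontrivial combination r of the vₛ vanishing off the coordinates j and k
    open NontrivialRelation (dependent n (λ s t → v s (punchIn j (punchIn k′ t))))
    r : Vecℤ (suc (suc n))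
    r i = Σℤ (λ s → coeff s * v s i)

    pairing : ∀ {w} → Orthogonal m v w → w j * r j + w k * r k ≈ + 0 ⟨mod m ⟩
    pairing {w} w⊥v = +-vanishˡ (≈-trans (≈-reflexive (sym assoc)) w·r≈0)
      (Σ-*-vanishing (λ t → w (punchIn j (punchIn k′ t))) relation)
      where
      rest : ℤ
      rest = Σℤ (λ t → w (punchIn j (punchIn k′ t)) * r (punchIn j (punchIn k′ t)))
      w·r≈0 : w · r ≈ + 0 ⟨mod m ⟩
      w·r≈0 = orthogonal-combination {m} v {w} w⊥v coeff
      assoc : w · r ≡ w j * r j + w k * r k + rest
      assoc = trans (Σ-remove j (λ i → w i * r i))
        (trans (cong (_+_ (w j * r j)) (Σ-remove k′ (λ i → w (punchIn j i) * r (punchIn j i))))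
               (sym (ℤP.+-assoc (w j * r j) (w k * r k) rest)))

    r≈0 : ¬ u k ≈ + 0 ⟨mod m ⟩ → ∀ i → r i ≈ + 0 ⟨mod m ⟩
    r≈0 uk≉0 = punchIn-elim j rj≈0 (punchIn-elim k′ rk≈0 relation)
      where
      rk≈0 : r k ≈ + 0 ⟨mod m ⟩
      rk≈0 = cancelˡ uk≉0 (+-vanishˡ (≈-trans (≈-reflexive (ℤP.+-comm (u k * r k) (u j * r j))) (pairing {u} u⊥v))
                                        (≈-trans (*-cong uj≈0 (≈-refl {a = r j})) (≈-reflexive refl)))
      rj≈0 : r j ≈ + 0 ⟨mod m ⟩
      rj≈0 = cancelˡ xj≉0 (+-vanishˡ (pairing {x} x⊥v) (≈-trans (*-cong (≈-refl {a = x k}) rk≈0)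
                                                               (≈-reflexive (ℤP.*-zeroʳ (x k)))))

  orthogonal-line : ∀ {n} (v : Fin n → Vecℤ (suc n)) → Independent m v →
    ∀ {x y} → Orthogonal m v x → Orthogonal m v y →
    ∀ j → ¬ x j ≈ + 0 ⟨mod m ⟩ → ∀ i → x j * y i ≈ y j * x i ⟨mod m ⟩
  orthogonal-line {n} v indep {x} {y} x⊥v y⊥v j xj≉0 i = difference≈0⇒≈ (u≈0 i)
    where
    u : Vecℤ (suc n)
    u i = x j * y i - y j * x i
    uj≈0 : u j ≈ + 0 ⟨mod m ⟩
    uj≈0 = ≈-reflexive (cancel (x j) (y j))
      where cancel : ∀ a b → a * b - b * a ≡ + 0
            cancel = solve-∀
    u≈0 : ∀ i → u i ≈ + 0 ⟨mod m ⟩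
    u≈0 = punchIn-elim j uj≈0
      (orthogonal-support v indep {x} {u} x⊥v (orthogonal-difference {m} v {x} {y} x⊥v y⊥v (x j) (y j)) j xj≉0 uj≈0)

toℚᵘ-toℚ : ∀ a → ℚ.toℚᵘ (toℚ a) ≃ᵘ mkℚᵘ a 0
toℚᵘ-toℚ a = ℚP.toℚᵘ-fromℚᵘ (mkℚᵘ a 0)

toℚ-injective : ∀ {a b} → toℚ a ≡ toℚ b → a ≡ b
toℚ-injective {a} {b} eq with ℚᵘP.≃-trans (ℚᵘP.≃-sym (toℚᵘ-toℚ a)) (ℚᵘP.≃-trans (ℚP.toℚᵘ-cong eq) (toℚᵘ-toℚ b))
... | ℚᵘ.*≡* a·1≡b·1 = trans (sym (ℤP.*-identityʳ a)) (trans a·1≡b·1 (ℤP.*-identityʳ b))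

toℚ-+ : ∀ a b → toℚ (a + b) ≡ toℚ a ℚ.+ toℚ b
toℚ-+ a b = ℚP.toℚᵘ-injective (begin
  ℚ.toℚᵘ (toℚ (a + b))                  ≈⟨ toℚᵘ-toℚ (a + b) ⟩
  mkℚᵘ (a + b) 0                        ≈⟨ ℚᵘ.*≡* (fraction a b) ⟩
  mkℚᵘ a 0 ℚᵘ.+ mkℚᵘ b 0                ≈⟨ ℚᵘP.+-cong (toℚᵘ-toℚ a) (toℚᵘ-toℚ b) ⟨
  ℚ.toℚᵘ (toℚ a) ℚᵘ.+ ℚ.toℚᵘ (toℚ b)    ≈⟨ ℚP.toℚᵘ-homo-+ (toℚ a) (toℚ b) ⟨
  ℚ.toℚᵘ (toℚ a ℚ.+ toℚ b)              ∎)
  where open ℚᵘP.≃-Reasoning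
        fraction : ∀ a b → (a + b) * + 1 ≡ (a * + 1 + b * + 1) * + 1
        fraction = solve-∀

toℚ-* : ∀ a b → toℚ (a * b) ≡ toℚ a ℚ.* toℚ b
toℚ-* a b = ℚP.toℚᵘ-injective (begin
  ℚ.toℚᵘ (toℚ (a * b))                  ≈⟨ toℚᵘ-toℚ (a * b) ⟩
  mkℚᵘ (a * b) 0                        ≈⟨ ℚᵘP.≃-refl ⟩
  mkℚᵘ a 0 ℚᵘ.* mkℚᵘ b 0                ≈⟨ ℚᵘP.*-cong (toℚᵘ-toℚ a) (toℚᵘ-toℚ b) ⟨
  ℚ.toℚᵘ (toℚ a) ℚᵘ.* ℚ.toℚᵘ (toℚ b)    ≈⟨ ℚP.toℚᵘ-homo-* (toℚ a) (toℚ b) ⟨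
  ℚ.toℚᵘ (toℚ a ℚ.* toℚ b)              ∎)
  where open ℚᵘP.≃-Reasoning

Σℚ-cong : ∀ {n} {f g : Fin n → ℚ} → (∀ i → f i ≡ g i) → Σℚ f ≡ Σℚ g
Σℚ-cong {zero} f≗g = refl
Σℚ-cong {suc n} f≗g = cong₂ ℚ._+_ (f≗g F.zero) (Σℚ-cong (f≗g ∘ F.suc))

Σℚ-*ˡ : ∀ {n} c (f : Fin n → ℚ) → Σℚ (λ i → c ℚ.* f i) ≡ c ℚ.* Σℚ f
Σℚ-*ˡ {zero} c f = sym (ℚP.*-zeroʳ c)
Σℚ-*ˡ {suc n} c f = trans (cong (ℚ._+_ (c ℚ.* f F.zero)) (Σℚ-*ˡ c (f ∘ F.suc))) (sym (ℚP.*-distribˡ-+ c _ _))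

toℚ-Σ : ∀ {n} (f : Fin n → ℤ) → toℚ (Σℤ f) ≡ Σℚ (toℚ ∘ f)
toℚ-Σ {zero} f = refl
toℚ-Σ {suc n} f = trans (toℚ-+ (f F.zero) (Σℤ (f ∘ F.suc))) (cong (ℚ._+_ (toℚ (f F.zero))) (toℚ-Σ (f ∘ F.suc)))

record ScaledOrthogonal {n} (A : Matℤ n n) (ℓ : ℕ) (L : Matℤ n n) : Set where
  field
    gram : ∀ i j → column L i · column L j ≡ + ℓ * + ℓ * δ i j
    row-sum : ∀ i → Σℤ (L i) ≡ + ℓ
    B : Matℤ n n
    conjugate : ∀ i j → column L i · (A ·ᵥ column L j) ≡ + ℓ * + ℓ * B i j

module ScaledMatrix {n : ℕ} (Q : Matℚ n n) (ℓ : ℕ) (L : Matℤ n n)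
                    (L≡ℓQ : ∀ i j → toℚ (L i j) ≡ scaleℚ ℓ (Q i j)) where
  ℓℚ : ℚ
  ℓℚ = toℚ (+ ℓ)

  scaled-dot : ∀ (x y : Vecℤ n) (X Y : Fin n → ℚ) →
    (∀ k → toℚ (x k) ≡ ℓℚ ℚ.* X k) → (∀ k → toℚ (y k) ≡ ℓℚ ℚ.* Y k) →
    toℚ (x · y) ≡ toℚ (+ ℓ * + ℓ) ℚ.* Σℚ (λ k → X k ℚ.* Y k)
  scaled-dot x y X Y x≡ℓX y≡ℓY = begin
    toℚ (x · y)                                   ≡⟨ toℚ-Σ (λ k → x k * y k) ⟩
    Σℚ (λ k → toℚ (x k * y k))                    ≡⟨ Σℚ-cong (λ k → trans (toℚ-* (x k) (y k)) (cong₂ ℚ._*_ (x≡ℓX k) (y≡ℓY k))) ⟩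
    Σℚ (λ k → (ℓℚ ℚ.* X k) ℚ.* (ℓℚ ℚ.* Y k))      ≡⟨ Σℚ-cong (λ k → ℚ-interchange ℓℚ (X k) ℓℚ (Y k)) ⟩
    Σℚ (λ k → (ℓℚ ℚ.* ℓℚ) ℚ.* (X k ℚ.* Y k))      ≡⟨ Σℚ-*ˡ (ℓℚ ℚ.* ℓℚ) (λ k → X k ℚ.* Y k) ⟩
    (ℓℚ ℚ.* ℓℚ) ℚ.* Σℚ (λ k → X k ℚ.* Y k)        ≡⟨ cong (ℚ._* Σℚ (λ k → X k ℚ.* Y k)) (sym (toℚ-* (+ ℓ) (+ ℓ))) ⟩
    toℚ (+ ℓ * + ℓ) ℚ.* Σℚ (λ k → X k ℚ.* Y k)    ∎
    where open ≡-Reasoning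

  scaled-apply : ∀ (A : Matℤ n n) j k →
    toℚ ((A ·ᵥ column L j) k) ≡ ℓℚ ℚ.* mulℚ (toℚMat A) Q k j
  scaled-apply A j k = begin
    toℚ (Σℤ (λ m → A k m * L m j))               ≡⟨ toℚ-Σ (λ m → A k m * L m j) ⟩
    Σℚ (λ m → toℚ (A k m * L m j))               ≡⟨ Σℚ-cong (λ m → trans (toℚ-* (A k m) (L m j)) (cong (toℚ (A k m) ℚ.*_) (L≡ℓQ m j))) ⟩
    Σℚ (λ m → toℚ (A k m) ℚ.* (ℓℚ ℚ.* Q m j))   ≡⟨ Σℚ-cong (λ m → ℚ-x∙yz≈y∙xz (toℚ (A k m)) ℓℚ (Q m j)) ⟩
    Σℚ (λ m → ℓℚ ℚ.* (toℚ (A k m) ℚ.* Q m j))   ≡⟨ Σℚ-*ˡ ℓℚ (λ m → toℚ (A k m) ℚ.* Q m j) ⟩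
    ℓℚ ℚ.* mulℚ (toℚMat A) Q k j                 ∎
    where open ≡-Reasoning

  orthogonal-δ : IsOrthogonal Q → ∀ i j → transposeMulℚ Q Q i j ≡ toℚ (δ i j)
  orthogonal-δ orth i j with orth i j
  ... | QᵀQ≡δ with i F.≟ j
  ...   | yes _ = QᵀQ≡δ
  ...   | no _ = QᵀQ≡δ

  zero-one-integral : ∀ {q} → q ≡ ℚ.0ℚ ⊎ q ≡ ℚ.1ℚ → ∃ λ b → q ≡ toℚ b
  zero-one-integral (inj₁ q≡0) = + 0 , q≡0
  zero-one-integral (inj₂ q≡1) = + 1 , q≡1

  scaled-integral : ∀ {a q b} → toℚ a ≡ toℚ (+ ℓ * + ℓ) ℚ.* q → q ≡ toℚ b → a ≡ + ℓ * + ℓ * b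
  scaled-integral {b = b} a≡ℓ²q q≡b =
    toℚ-injective (trans a≡ℓ²q (trans (cong (toℚ (+ ℓ * + ℓ) ℚ.*_) q≡b) (sym (toℚ-* (+ ℓ * + ℓ) b))))

  scaled-orthogonal : ∀ (A : Matℤ n n) → IsOrthogonal Q → FixesOnes Q →
    IsAdjacencyℚ (transposeMulℚ Q (mulℚ (toℚMat A) Q)) → ScaledOrthogonal A ℓ L
  scaled-orthogonal A orth Qe≡e (_ , zero-one , _) = record
    { gram = λ i j → scaled-integral (scaled-dot (column L i) (column L j) _ _ (λ k → L≡ℓQ k i) (λ k → L≡ℓQ k j))
                                     (orthogonal-δ orth i j)
    ; row-sum = row-sum
    ; B = λ i j → proj₁ (entry i j)
    ; conjugate = λ i j → scaled-integral
        (scaled-dot (column L i) (A ·ᵥ column L j) _ _ (λ k → L≡ℓQ k i) (scaled-apply A j))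
        (proj₂ (entry i j))
    }
    where
    entry : ∀ i j → ∃ λ b → transposeMulℚ Q (mulℚ (toℚMat A) Q) i j ≡ toℚ b
    entry i j = zero-one-integral (zero-one i j)
    row-sum : ∀ i → Σℤ (L i) ≡ + ℓ
    row-sum i = toℚ-injective (begin
      toℚ (Σℤ (L i))              ≡⟨ toℚ-Σ (L i) ⟩
      Σℚ (λ j → toℚ (L i j))      ≡⟨ Σℚ-cong (L≡ℓQ i) ⟩
      Σℚ (λ j → ℓℚ ℚ.* Q i j)     ≡⟨ Σℚ-*ˡ ℓℚ (Q i) ⟩
      ℓℚ ℚ.* Σℚ (Q i)             ≡⟨ cong (ℓℚ ℚ.*_) (Qe≡e i) ⟩
      ℓℚ ℚ.* ℚ.1ℚ                 ≡⟨ ℚP.*-identityʳ ℓℚ ⟩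
      ℓℚ                          ∎)
      where open ≡-Reasoning

module ScaledOrthogonalProperties {n : ℕ} {A : Matℤ n n} {ℓ′ : ℕ} {L : Matℤ n n}
                                  (S : ScaledOrthogonal A (suc ℓ′) L) where
  open ScaledOrthogonal S
  ℓ : ℕ
  ℓ = suc ℓ′
  ℓ² : ℤ
  ℓ² = + ℓ * + ℓ

  gram-combination : ∀ (c : Fin n → ℤ) r → column L r · (λ t → Σℤ (λ s → c s * L t s)) ≡ ℓ² * c r
  gram-combination c r = begin
    Σℤ (λ t → L t r * Σℤ (λ s → c s * L t s))    ≡⟨ Σ-distrib-swap (column L r) (λ t s → c s * L t s) ⟩
    Σℤ (λ s → Σℤ (λ t → L t r * (c s * L t s)))  ≡⟨ Σ-cong (λ s → trans (Σ-cong (λ t → regroup (L t r) (c s) (L t s))) (Σ-*ʳ (λ t → L t r * L t s) (c s))) ⟩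
    Σℤ (λ s → (column L r · column L s) * c s)   ≡⟨ Σ-cong (λ s → cong (_* c s) (trans (gram r s) (cong (ℓ² *_) (δ-sym r s)))) ⟩
    Σℤ (λ s → ℓ² * δ s r * c s)                  ≡⟨ Σ-cong (λ s → regroup′ ℓ² (δ s r) (c s)) ⟩
    Σℤ (λ s → ℓ² * (c s * δ s r))                ≡⟨ Σ-*ˡ ℓ² (λ s → c s * δ s r) ⟩
    ℓ² * Σℤ (λ s → c s * δ s r)                  ≡⟨ cong (ℓ² *_) (Σ-δ c r) ⟩
    ℓ² * c r                                     ∎
    where open ≡-Reasoning
          regroup : ∀ l c m → l * (c * m) ≡ l * m * c
          regroup = solve-∀
          regroup′ : ∀ a d c → a * d * c ≡ a * (c * d)
          regroup′ = solve-∀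

  -- Dually, L(Lᵀf) = ℓ²f; equivalently LLᵀ = ℓ²I.  This needs that only the
  -- zero vector is orthogonal to all columns of L, which comes from the
  -- dependence of n + 1 vectors in ℤⁿ.
  orthogonal-to-columns : ∀ y → (∀ r → column L r · y ≡ + 0) → ∀ t → y t ≡ + 0
  orthogonal-to-columns y L⊥y t =
    ≈-mod0⇒≡ (DomainModulus.cancelˡ integer-domain c₀≉0 (≈-reflexive c₀yt≡0))
    where
    -- a nontrivial relation c₀y + Σᵣ cᵣ₊₁ Lᵣ = 0 among y and the columns of L
    open NontrivialRelation (Dependence.dependent integer-domain n (y ∷ column L))
    combination : Vecℤ n
    combination t = Σℤ (λ r → coeff (F.suc r) * L t r)
    relationℤ : ∀ t → coeff F.zero * y t + combination t ≡ + 0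
    relationℤ t = ≈-mod0⇒≡ (relation t)
    -- pairing the relation with the column Lᵣ leaves ℓ² cᵣ₊₁
    c-suc≡0 : ∀ r → coeff (F.suc r) ≡ + 0
    c-suc≡0 r = ℤP.*-cancelˡ-≡ ℓ² (coeff (F.suc r)) (+ 0) (begin
      ℓ² * coeff (F.suc r)                                  ≡⟨ sym (gram-combination (coeff ∘ F.suc) r) ⟩
      column L r · combination                              ≡⟨ sym (ℤP.+-identityˡ _) ⟩
      + 0 + column L r · combination
        ≡⟨ cong (_+ column L r · combination) (sym (trans (cong (coeff F.zero *_) (L⊥y r)) (ℤP.*-zeroʳ (coeff F.zero)))) ⟩
      coeff F.zero * (column L r · y) + column L r · combination ≡⟨ sym (·-add (column L r) (coeff F.zero) y combination) ⟩
      column L r · (λ t → coeff F.zero * y t + combination t) ≡⟨ ·-zeroʳ (column L r) relationℤ ⟩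
      + 0                                                   ≡⟨ sym (ℤP.*-zeroʳ ℓ²) ⟩
      ℓ² * + 0                                              ∎)
      where open ≡-Reasoning
    c₀yt≡0 : coeff F.zero * y t ≡ + 0
    c₀yt≡0 = trans (sym (ℤP.+-identityʳ _))
      (trans (cong (_+_ (coeff F.zero * y t)) (sym (trans (Σ-cong (λ r → cong (_* L t r) (c-suc≡0 r))) (Σ-zero n))))
             (relationℤ t))
    -- so the nonzero coefficient of the relation is c₀
    c₀≉0 : ¬ coeff F.zero ≈ + 0 ⟨mod 0 ⟩
    c₀≉0 with witness | nontrivial
    ... | F.zero | c₀≉0 = c₀≉0
    ... | F.suc r | c≉0 = ⊥-elim (c≉0 (≈-reflexive (c-suc≡0 r)))

  row-gram : ∀ j t → Σℤ (λ s → L j s * L t s) ≡ ℓ² * δ t j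
  row-gram j t = cancel {ℓ²} {δ t j} (orthogonal-to-columns y L⊥y t)
    where
    y : Vecℤ n
    y t = - ℓ² * δ t j + Σℤ (λ s → L j s * L t s)
    L⊥y : ∀ r → column L r · y ≡ + 0
    L⊥y r = begin
      column L r · y                                               ≡⟨ ·-add (column L r) (- ℓ²) (λ t → δ t j) _ ⟩
      - ℓ² * Σℤ (λ t → L t r * δ t j) + column L r · (λ t → Σℤ (λ s → L j s * L t s))
        ≡⟨ cong₂ (λ a b → - ℓ² * a + b) (Σ-δ (column L r) j) (gram-combination (L j) r) ⟩
      - ℓ² * L j r + ℓ² * L j r                                   ≡⟨ vanish ℓ² (L j r) ⟩
      + 0                                                         ∎
      where open ≡-Reasoning
            vanish : ∀ a b → - a * b + a * b ≡ + 0
            vanish = solve-∀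
    cancel : ∀ {a d b} → - a * d + b ≡ + 0 → b ≡ a * d
    cancel {a} {d} {b} eq = trans (shift a d b) (trans (cong (_+ a * d) eq) (ℤP.+-identityˡ (a * d)))
      where shift : ∀ a d b → b ≡ (- a * d + b) + a * d
            shift = solve-∀

  row-gram-combination : ∀ (f : Vecℤ n) i → Σℤ (λ r → L i r * (column L r · f)) ≡ ℓ² * f i
  row-gram-combination f i = begin
    Σℤ (λ r → L i r * Σℤ (λ k → L k r * f k))    ≡⟨ Σ-distrib-swap (L i) (λ r k → L k r * f k) ⟩
    Σℤ (λ k → Σℤ (λ r → L i r * (L k r * f k)))  ≡⟨ Σ-cong (λ k → trans (Σ-cong (λ r → sym (ℤP.*-assoc (L i r) (L k r) (f k))))
                                                                      (Σ-*ʳ (λ r → L i r * L k r) (f k))) ⟩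
    Σℤ (λ k → Σℤ (λ r → L i r * L k r) * f k)    ≡⟨ Σ-cong (λ k → cong (_* f k) (row-gram i k)) ⟩
    Σℤ (λ k → ℓ² * δ k i * f k)                  ≡⟨ Σ-cong (λ k → regroup ℓ² (δ k i) (f k)) ⟩
    Σℤ (λ k → ℓ² * (f k * δ k i))                ≡⟨ Σ-*ˡ ℓ² (λ k → f k * δ k i) ⟩
    ℓ² * Σℤ (λ k → f k * δ k i)                  ≡⟨ cong (ℓ² *_) (Σ-δ f i) ⟩
    ℓ² * f i                                     ∎
    where open ≡-Reasoning
          regroup : ∀ a d c → a * d * c ≡ a * (c * d)
          regroup = solve-∀

  -- A L = L B, since LᵀAL = ℓ²B and L Lᵀ = ℓ²I.
  AL≡LB : ∀ c i → (A ·ᵥ column L c) i ≡ Σℤ (λ r → B r c * L i r)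
  AL≡LB c i = ℤP.*-cancelˡ-≡ ℓ² _ _ (begin
    ℓ² * (A ·ᵥ column L c) i                          ≡⟨ sym (row-gram-combination (A ·ᵥ column L c) i) ⟩
    Σℤ (λ r → L i r * (column L r · (A ·ᵥ column L c))) ≡⟨ Σ-cong (λ r → cong (L i r *_) (conjugate r c)) ⟩
    Σℤ (λ r → L i r * (ℓ² * B r c))                   ≡⟨ Σ-cong (λ r → regroup (L i r) ℓ² (B r c)) ⟩
    Σℤ (λ r → ℓ² * (B r c * L i r))                   ≡⟨ Σ-*ˡ ℓ² (λ r → B r c * L i r) ⟩
    ℓ² * Σℤ (λ r → B r c * L i r)                     ∎)
    where open ≡-Reasoning
          regroup : ∀ l a b → l * (a * b) ≡ a * (b * l)
          regroup = solve-∀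

  column-sum : ∀ c → Σℤ (column L c) ≡ + ℓ
  column-sum c = ℤP.*-cancelʳ-≡ _ _ (+ ℓ) (begin
    Σℤ (column L c) * + ℓ                             ≡⟨ sym (Σ-*ʳ (column L c) (+ ℓ)) ⟩
    column L c · (λ _ → + ℓ)                          ≡⟨ Σ-cong (λ t → cong (L t c *_) (sym row-sum′)) ⟩
    column L c · (λ t → Σℤ (λ s → + 1 * L t s))       ≡⟨ gram-combination (λ _ → + 1) c ⟩
    ℓ² * + 1                                          ≡⟨ ℤP.*-identityʳ ℓ² ⟩
    + ℓ * + ℓ                                         ∎)
    where open ≡-Reasoning
          row-sum′ : ∀ {t} → Σℤ (λ s → + 1 * L t s) ≡ + ℓ
          row-sum′ {t} = trans (Σ-cong (λ s → ℤP.*-identityˡ (L t s))) (row-sum t)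

  -- If p ∣ ℓ, every column of L is orthogonal modulo p to every walk vector
  -- Aᵏe: for k = 0 by the column sums, and inductively because AL = LB.
  walk-orthogonal : (∀ i j → A i j ≡ A j i) → ∀ {p} → p ∣ ℓ →
    ∀ c → Orthogonal p (column (walkMatrix A)) (column L c)
  walk-orthogonal symm {p} p∣ℓ c k = powers (F.toℕ k) c
    where
    powers : ∀ k c → powOnes A k · column L c ≈ + 0 ⟨mod p ⟩
    powers zero c = ≈-trans (≈-reflexive (trans (Σ-cong (λ i → ℤP.*-identityˡ (L i c))) (column-sum c)))
                            (∣⇒≈0 p∣ℓ)
    powers (suc k) c = ≈-trans (≈-reflexive (begin
      (A ·ᵥ y) · column L c                             ≡⟨ sym (self-adjoint symm y (column L c)) ⟩
      y · (A ·ᵥ column L c)                             ≡⟨ Σ-cong (λ i → cong (y i *_) (AL≡LB c i)) ⟩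
      y · (λ i → Σℤ (λ r → B r c * L i r))              ∎))
      (orthogonal-combination (column L) {y} (λ r → ≈-trans (≈-reflexive (·-comm (column L r) y)) (powers k r))
                              (λ r → B r c))
      where open ≡-Reasoning
            y : Vecℤ n
            y = powOnes A k

  -- If p ∣ ℓ, the columns of L are isotropic modulo p² for both forms I and A,
  -- since LᵀL = ℓ²I and LᵀAL = ℓ²B.
  isotropic-column : ∀ {p} → p ∣ ℓ → ∀ c →
    column L c · column L c ≈ + 0 ⟨mod p ℕ.* p ⟩ × column L c · (A ·ᵥ column L c) ≈ + 0 ⟨mod p ℕ.* p ⟩
  isotropic-column {p} p∣ℓ c =
    ≈-trans (≈-reflexive (gram c c)) (ℓ²-multiple (δ c c)) ,
    ≈-trans (≈-reflexive (conjugate c c)) (ℓ²-multiple (B c c))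
    where
    ℓ≈0 : + ℓ ≈ + 0 ⟨mod p ⟩
    ℓ≈0 = ∣⇒≈0 p∣ℓ
    ℓ²-multiple : ∀ b → ℓ² * b ≈ + 0 ⟨mod p ℕ.* p ⟩
    ℓ²-multiple b = ≈-trans (*-cong (*-multiples ℓ≈0 ℓ≈0) (≈-refl {a = b})) (≈-reflexive refl)

divide : ∀ {p a} → Prime p → ¬ a ≈ + 0 ⟨mod p ⟩ → ∀ b →
  ∃ λ c → ∀ {x y} → a * x ≈ b * y ⟨mod p ⟩ → x ≈ c * y ⟨mod p ⟩
divide {p} {a} pp a≉0 b with inverse pp a≉0
... | w , wa≈1 = w * b , λ {x} {y} ax≈by → begin
  x              ≡⟨ sym (ℤP.*-identityˡ x) ⟩
  + 1 * x        ≈⟨ *-cong (≈-sym wa≈1) (≈-refl {a = x}) ⟩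
  w * a * x      ≡⟨ ℤP.*-assoc w a x ⟩
  w * (a * x)    ≈⟨ *-cong (≈-refl {a = w}) ax≈by ⟩
  w * (b * y)    ≡⟨ sym (ℤP.*-assoc w b y) ⟩
  w * b * y      ∎
  where open ≈-Reasoning p

proportional-unit : ∀ {p n} → Prime p → ∀ {x y : Vecℤ n} j → ¬ x j ≈ + 0 ⟨mod p ⟩ →
  (∀ i → x j * y i ≈ y j * x i ⟨mod p ⟩) → ∀ i₀ → ¬ y i₀ ≈ + 0 ⟨mod p ⟩ →
  ∃ λ c → ¬ c ≈ + 0 ⟨mod p ⟩ × (∀ i → y i ≈ c * x i ⟨mod p ⟩)
proportional-unit pp {x} {y} j xj≉0 proportional i₀ yi₀≉0 = c , c≉0 , y≈cx
  where
  scaling : ∃ λ c → ∀ {a b} → x j * a ≈ y j * b ⟨mod _ ⟩ → a ≈ c * b ⟨mod _ ⟩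
  scaling = divide pp xj≉0 (y j)
  c : ℤ
  c = proj₁ scaling
  y≈cx : ∀ i → y i ≈ c * x i ⟨mod _ ⟩
  y≈cx i = proj₂ scaling (proportional i)
  c≉0 : ¬ c ≈ + 0 ⟨mod _ ⟩
  c≉0 c≈0 = yi₀≉0 (≈-trans (y≈cx i₀) (≈-trans (*-cong c≈0 (≈-refl {a = x i₀})) (≈-reflexive refl)))

·ᵥ-scalar : ∀ {n} (A : Matℤ n n) c (x : Vecℤ n) i → c * (A ·ᵥ x) i ≡ (A ·ᵥ (λ k → c * x k)) i
·ᵥ-scalar A c x i = trans (sym (Σ-*ˡ c (λ k → A i k * x k))) (Σ-cong (λ k → regroup c (A i k) (x k)))
  where regroup : ∀ c a x → c * (a * x) ≡ a * (c * x)
        regroup = solve-∀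

·ᵥ-congₘ : ∀ {m n} (A : Matℤ n n) {x y : Vecℤ n} → (∀ k → x k ≈ y k ⟨mod m ⟩) →
  ∀ i → (A ·ᵥ x) i ≈ (A ·ᵥ y) i ⟨mod m ⟩
·ᵥ-congₘ A x≈y i = Σ-congₘ (λ k → *-cong (≈-refl {a = A i k}) (x≈y k))

scaled-eigenvector : ∀ {m n} (A L B : Matℤ n n) →
  (∀ c i → (A ·ᵥ column L c) i ≡ Σℤ (λ r → B r c * L i r)) →
  ∀ (z : Vecℤ n) j → (∀ c i → z j * L i c ≈ L j c * z i ⟨mod m ⟩) →
  ∀ c i → L j c * (A ·ᵥ z) i ≈ Σℤ (λ r → B r c * L j r) * z i ⟨mod m ⟩
scaled-eigenvector {m} A L B AL≡LB z j proportional c i = begin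
  L j c * (A ·ᵥ z) i                        ≡⟨ ·ᵥ-scalar A (L j c) z i ⟩
  (A ·ᵥ (λ k → L j c * z k)) i              ≈⟨ ·ᵥ-congₘ A (λ k → ≈-sym (proportional c k)) i ⟩
  (A ·ᵥ (λ k → z j * L k c)) i              ≡⟨ sym (·ᵥ-scalar A (z j) (column L c) i) ⟩
  z j * (A ·ᵥ column L c) i                 ≡⟨ cong (z j *_) (AL≡LB c i) ⟩
  z j * Σℤ (λ r → B r c * L i r)            ≡⟨ sym (Σ-*ˡ (z j) (λ r → B r c * L i r)) ⟩
  Σℤ (λ r → z j * (B r c * L i r))          ≡⟨ Σ-cong (λ r → regroup (z j) (B r c) (L i r)) ⟩
  Σℤ (λ r → B r c * (z j * L i r))          ≈⟨ Σ-congₘ (λ r → *-cong (≈-refl {a = B r c}) (proportional r i)) ⟩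
  Σℤ (λ r → B r c * (L j r * z i))          ≡⟨ Σ-cong (λ r → sym (ℤP.*-assoc (B r c) (L j r) (z i))) ⟩
  Σℤ (λ r → B r c * L j r * z i)            ≡⟨ Σ-*ʳ (λ r → B r c * L j r) (z i) ⟩
  Σℤ (λ r → B r c * L j r) * z i            ∎
  where open ≈-Reasoning m
        regroup : ∀ t b l → t * (b * l) ≡ b * (t * l)
        regroup = solve-∀

eigenvector-mod-p : ∀ {p n} (A L B : Matℤ n n) → Prime p →
  (∀ c i → (A ·ᵥ column L c) i ≡ Σℤ (λ r → B r c * L i r)) →
  ∀ (z : Vecℤ n) j → (∀ c i → z j * L i c ≈ L j c * z i ⟨mod p ⟩) →
  ∀ c → ¬ L j c ≈ + 0 ⟨mod p ⟩ → ∃ λ λ₀ → ∀ i → (A ·ᵥ z) i ≈ λ₀ * z i ⟨mod p ⟩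
eigenvector-mod-p A L B pp AL≡LB z j proportional c Ljc≉0 =
  proj₁ eigenvalue , λ i → proj₂ eigenvalue (scaled-eigenvector A L B AL≡LB z j proportional c i)
  where eigenvalue : ∃ λ μ → ∀ {a b} → L j c * a ≈ Σℤ (λ r → B r c * L j r) * b ⟨mod _ ⟩ → a ≈ μ * b ⟨mod _ ⟩
        eigenvalue = divide pp Ljc≉0 (Σℤ (λ r → B r c * L j r))

·-perturb : ∀ {m k n} {x x′ y : Vecℤ n} → (∀ i → x i ≈ x′ i ⟨mod m ⟩) → (∀ i → y i ≈ + 0 ⟨mod k ⟩) →
  x · y ≈ x′ · y ⟨mod m ℕ.* k ⟩
·-perturb x≈x′ y≈0 = Σ-congₘ (λ i → *-perturb (x≈x′ i) (y≈0 i))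

·-scaleˡ : ∀ {n} c (x y : Vecℤ n) → (λ i → c * x i) · y ≡ c * (x · y)
·-scaleˡ c x y = trans (Σ-cong (λ i → ℤP.*-assoc c (x i) (y i))) (Σ-*ˡ c (λ i → x i * y i))

residual : ∀ {n} → Matℤ n n → ℤ → Vecℤ n → Vecℤ n
residual A λ₀ x i = (A ·ᵥ x) i - λ₀ * x i

·-residual : ∀ {n} (A : Matℤ n n) λ₀ (x y : Vecℤ n) →
  x · residual A λ₀ y ≡ x · (A ·ᵥ y) - λ₀ * (x · y)
·-residual A λ₀ x y = begin
  Σℤ (λ i → x i * ((A ·ᵥ y) i - λ₀ * y i))                   ≡⟨ Σ-cong (λ i → expand (x i) ((A ·ᵥ y) i) λ₀ (y i)) ⟩
  Σℤ (λ i → x i * (A ·ᵥ y) i + - λ₀ * (x i * y i))           ≡⟨ Σ-+ (λ i → x i * (A ·ᵥ y) i) (λ i → - λ₀ * (x i * y i)) ⟩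
  x · (A ·ᵥ y) + Σℤ (λ i → - λ₀ * (x i * y i))               ≡⟨ cong (_+_ (x · (A ·ᵥ y))) (Σ-*ˡ (- λ₀) (λ i → x i * y i)) ⟩
  x · (A ·ᵥ y) + - λ₀ * (x · y)                              ≡⟨ cong (_+_ (x · (A ·ᵥ y))) (sym (ℤP.neg-distribˡ-* λ₀ (x · y))) ⟩
  x · (A ·ᵥ y) - λ₀ * (x · y)                                ∎
  where open ≡-Reasoning
        expand : ∀ x u l y → x * (u - l * y) ≡ x * u + - l * (x * y)
        expand = solve-∀

residual≈0 : ∀ {m n} (A : Matℤ n n) λ₀ {z X : Vecℤ n} v →
  (∀ i → X i ≈ v * z i ⟨mod m ⟩) → (∀ i → (A ·ᵥ z) i ≈ λ₀ * z i ⟨mod m ⟩) →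
  ∀ i → residual A λ₀ X i ≈ + 0 ⟨mod m ⟩
residual≈0 {m} A λ₀ {z} {X} v X≈vz Az≈λ₀z i = begin
  (A ·ᵥ X) i - λ₀ * X i                     ≈⟨ sub-cong (·ᵥ-congₘ A X≈vz i) (*-cong (≈-refl {a = λ₀}) (X≈vz i)) ⟩
  (A ·ᵥ (λ k → v * z k)) i - λ₀ * (v * z i) ≡⟨ cong (_- λ₀ * (v * z i)) (sym (·ᵥ-scalar A v z i)) ⟩
  v * (A ·ᵥ z) i - λ₀ * (v * z i)           ≈⟨ sub-cong (*-cong (≈-refl {a = v}) (Az≈λ₀z i)) (≈-refl {a = λ₀ * (v * z i)}) ⟩
  v * (λ₀ * z i) - λ₀ * (v * z i)           ≡⟨ vanish v λ₀ (z i) ⟩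
  + 0                                       ∎
  where open ≈-Reasoning m
        vanish : ∀ v l z → v * (l * z) - l * (v * z) ≡ + 0
        vanish = solve-∀

-- Replacing X by vz costs a
-- multiple of p times a residual, itself a multiple of p.
quadratic-lift : ∀ {p n} {A : Matℤ n n} → (∀ i j → A i j ≡ A j i) →
  ∀ λ₀ v {z X : Vecℤ n} → (∀ i → X i ≈ v * z i ⟨mod p ⟩) → (∀ i → (A ·ᵥ z) i ≈ λ₀ * z i ⟨mod p ⟩) →
  X · (A ·ᵥ X) - λ₀ * (X · X) ≈ v * v * (z · (A ·ᵥ z) - λ₀ * (z · z)) ⟨mod p ℕ.* p ⟩
quadratic-lift {p} {A = A} symm λ₀ v {z} {X} X≈vz Az≈λ₀z = begin
  X · (A ·ᵥ X) - λ₀ * (X · X)             ≡⟨ sym (·-residual A λ₀ X X) ⟩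
  X · rX                                  ≈⟨ ·-perturb X≈vz rX≈0 ⟩
  vz · rX                                 ≡⟨ ·-scaleˡ v z rX ⟩
  v * (z · rX)                            ≡⟨ cong (v *_) (·-residual A λ₀ z X) ⟩
  v * (z · (A ·ᵥ X) - λ₀ * (z · X))
    ≡⟨ cong (v *_) (cong₂ (λ a b → a - λ₀ * b) (trans (self-adjoint symm z X) (·-comm (A ·ᵥ z) X)) (·-comm z X)) ⟩
  v * (X · (A ·ᵥ z) - λ₀ * (X · z))       ≡⟨ cong (v *_) (sym (·-residual A λ₀ X z)) ⟩
  v * (X · rz)                            ≈⟨ *-cong (≈-refl {a = v}) (·-perturb X≈vz rz≈0) ⟩
  v * (vz · rz)                           ≡⟨ cong (v *_) (trans (·-scaleˡ v z rz) (cong (v *_) (·-residual A λ₀ z z))) ⟩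
  v * (v * (z · (A ·ᵥ z) - λ₀ * (z · z))) ≡⟨ sym (ℤP.*-assoc v v _) ⟩
  v * v * (z · (A ·ᵥ z) - λ₀ * (z · z))   ∎
  where
  open ≈-Reasoning (p ℕ.* p)
  vz : Vecℤ _
  vz i = v * z i
  rX rz : Vecℤ _
  rX = residual A λ₀ X
  rz = residual A λ₀ z
  rX≈0 : ∀ i → rX i ≈ + 0 ⟨mod p ⟩
  rX≈0 = residual≈0 A λ₀ v X≈vz Az≈λ₀z
  rz≈0 : ∀ i → rz i ≈ + 0 ⟨mod p ⟩
  rz≈0 = residual≈0 A λ₀ (+ 1) (λ i → ≈-reflexive (sym (ℤP.*-identityˡ (z i)))) Az≈λ₀z

quadratic-form-mod-p² : ∀ {p n} {A : Matℤ n n} → Prime p → (∀ i j → A i j ≡ A j i) →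
  ∀ {X z : Vecℤ n} {c λ₀} → ¬ c ≈ + 0 ⟨mod p ⟩ → (∀ i → X i ≈ c * z i ⟨mod p ⟩) →
  (∀ i → (A ·ᵥ z) i ≈ λ₀ * z i ⟨mod p ⟩) →
  X · X ≈ + 0 ⟨mod p ℕ.* p ⟩ × X · (A ·ᵥ X) ≈ + 0 ⟨mod p ℕ.* p ⟩ →
  z · (A ·ᵥ z) ≈ λ₀ * (z · z) ⟨mod p ^ 2 ⟩
quadratic-form-mod-p² {p} {A = A} pp symm {X} {z} {c} {λ₀} c≉0 X≈cz Az≈λ₀z (XX≈0 , XAX≈0) =
  mod-square {p} (difference≈0⇒≈ (square-cancel pp c≉0 (begin
    c * c * (z · (A ·ᵥ z) - λ₀ * (z · z))   ≈⟨ ≈-sym (quadratic-lift symm λ₀ c X≈cz Az≈λ₀z) ⟩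
    X · (A ·ᵥ X) - λ₀ * (X · X)             ≈⟨ sub-cong XAX≈0 (*-cong (≈-refl {a = λ₀}) XX≈0) ⟩
    + 0 - λ₀ * + 0                          ≡⟨ vanish λ₀ ⟩
    + 0                                     ∎)))
  where open ≈-Reasoning (p ℕ.* p)
        vanish : ∀ l → + 0 - l * + 0 ≡ + 0
        vanish = solve-∀

lemma3p3 : (n : ℕ) (A : Matℤ n n) → IsAdjacency A
    → det (walkMatrix A) ≢ + 0
    → (Q : Matℚ n n) → IsOrthogonal Q → FixesOnes Q
    → IsAdjacencyℚ (transposeMulℚ Q (mulℚ (toℚMat A) Q))
    → (ℓ : ℕ) → IsLevel Q ℓ
    → (p : ℕ) → Prime p → p ≢ 2 → p ∣ ℓ
    → HasRankMod p (walkMatrix A) (n ∸ 1)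
    → (L : Matℤ n n) → (∀ i j → toℚ (L i j) ≡ scaleℚ ℓ (Q i j))
    → HasRankMod p L 1
    → (z : Vecℤ n)
    → (∀ k → Σℤ (λ i → walkMatrix A i k * z i) ≡ + 0 [mod p ])
    → Σℤ (λ i → z i * z i) ≡ + 0 [mod p ]
    → (∃ λ i → ¬ (z i ≡ + 0 [mod p ]))
    → (∃ λ (λ₀ : ℤ) → ∀ i → (A ·ᵥ z) i ≡ λ₀ * z i [mod p ])
      × (∀ (λ₀ : ℤ) → (∀ i → (A ·ᵥ z) i ≡ λ₀ * z i [mod p ])
         → Σℤ (λ i → z i * (A ·ᵥ z) i) ≡ λ₀ * Σℤ (λ i → z i * z i) [mod p ^ 2 ])
lemma3p3 zero _ _ _ _ _ _ _ _ _ _ _ _ _ _ _ _ _ _ _ _ (() , _)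
lemma3p3 (suc _) _ _ _ _ _ _ _ zero (() , _) _ _ _ _ _ _ _ _ _ _ _ _
lemma3p3 (suc n₁) A (symm , _) _ Q orth Qe≡e QᵀAQ (suc ℓ′) _ p pp _ p∣ℓ ((σW , indepW) , _)
         L L≡ℓQ ((σL , indepL) , _) z W⊥z _ (j , zj≢0) = eigenvector , quadratic-form
  where
  S : ScaledOrthogonal A (suc ℓ′) L
  S = ScaledMatrix.scaled-orthogonal Q (suc ℓ′) L L≡ℓQ A orth Qe≡e QᵀAQ
  open ScaledOrthogonal S
  open ScaledOrthogonalProperties S
  zj≉0 : ¬ z j ≈ + 0 ⟨mod p ⟩
  zj≉0 = zj≢0 ∘ toMod
  -- z and the columns of L lie on the line orthogonal to n − 1 independent walk vectors
  proportional : ∀ c i → z j * L i c ≈ L j c * z i ⟨mod p ⟩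
  proportional c = Complement.orthogonal-line (prime-domain pp) (column (walkMatrix A) ∘ σW)
    (fromLinIndepMod indepW) {z} {column L c} (λ s → fromMod (W⊥z (σW s)))
    (λ s → walk-orthogonal symm p∣ℓ c (σW s)) j zj≉0
  -- the column of L independent modulo p has an entry ≢ 0, so it is a unit multiple c z
  col : Fin (suc n₁)
  col = σL F.zero
  nonzero-entry : ∃ λ i → ¬ L i col ≈ + 0 ⟨mod p ⟩
  nonzero-entry = independent-nonzero (prime-domain pp) (λ k i → L i (σL k))
                    (fromLinIndepMod {v = λ k i → L i (σL k)} indepL)
  unit : ∃ λ c → ¬ c ≈ + 0 ⟨mod p ⟩ × (∀ i → L i col ≈ c * z i ⟨mod p ⟩)
  unit = proportional-unit pp {z} {column L col} j zj≉0 (proportional col)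
           (proj₁ nonzero-entry) (proj₂ nonzero-entry)
  c : ℤ
  c = proj₁ unit
  c≉0 : ¬ c ≈ + 0 ⟨mod p ⟩
  c≉0 = proj₁ (proj₂ unit)
  L≈cz : ∀ i → L i col ≈ c * z i ⟨mod p ⟩
  L≈cz = proj₂ (proj₂ unit)
  Ljc≉0 : ¬ L j col ≈ + 0 ⟨mod p ⟩
  Ljc≉0 Ljc≈0 = DomainModulus.nonzero-* (prime-domain pp) c≉0 zj≉0 (≈-trans (≈-sym (L≈cz j)) Ljc≈0)

  eigen : ∃ λ λ₀ → ∀ i → (A ·ᵥ z) i ≈ λ₀ * z i ⟨mod p ⟩
  eigen = eigenvector-mod-p A L B pp AL≡LB z j proportional col Ljc≉0
  eigenvector : ∃ λ λ₀ → ∀ i → (A ·ᵥ z) i ≡ λ₀ * z i [mod p ]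
  eigenvector = proj₁ eigen , λ i → toMod (proj₂ eigen i)

  quadratic-form : ∀ λ₀ → (∀ i → (A ·ᵥ z) i ≡ λ₀ * z i [mod p ]) →
    Σℤ (λ i → z i * (A ·ᵥ z) i) ≡ λ₀ * Σℤ (λ i → z i * z i) [mod p ^ 2 ]
  quadratic-form λ₀ Az≡λ₀z = toMod (quadratic-form-mod-p² pp symm {column L col} {z} {λ₀ = λ₀}
    c≉0 L≈cz (λ i → fromMod (Az≡λ₀z i)) (isotropic-column p∣ℓ col))
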